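{- Fix an integer $n\ge1$, and let $m\ge 2$, $k\ge 1$, $p\ge 0$, $q\ge 0$ be integers. Consider the following diagram of graded rings, in which every horizontal and vertical arrow is the canonical projection described in the context: $$\begin{array}{ccccccc} \Lambda&\to&\Lambda_{m+p,\cdot}&\to&\Lambda_{m,\cdot}&\to&\Lambda_{m-1,\cdot}\\ \downarrow&&\downarrow&&\downarrow&&\downarrow\\ \Lambda_{\cdot,k+q}&\to&\Lambda_{m+p,k+q}&\to&\Lambda_{m,k+q}&\to&\Lambda_{m-1,k+q}\\ \downarrow&&\downarrow&&\downarrow&&\downarrow\\ \Lambda_{\cdot,k}&\to&\Lambda_{m+p,k}&\to&\Lambda_{m,k}&\to&\Lambda_{m-1,k}\\ \downarrow&&\downarrow&&\downarrow&&\downarrow\\ \Lambda_{\cdot,k-1}&\to&\Lambda_{m+p,k-1}&\to&\Lambda_{m,k-1}&\to&\Lambda_{m-1,k-1} \end{array}$$ This diagram is commutative in the sense that every one of its squares is commutative.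
   Context: Indeterminates: for integers $p\ge 1$, $d\ge 0$ and $1\le\mu_1,\dots,\mu_d\le n$ let $\mathbf a_{p\mu_1\dots\mu_d}$ be independent indeterminates (for $d=0$ this is $\mathbf a_p$). For $m\ge1$, $k\ge0$, $\Lambda_{m,k}$ is the graded ring of symmetric polynomials over $\mathbb Z$ in the indeterminates $\mathbf a_{p\mu_1\dots\mu_d}$ with $1\le p\le m$, $0\le d\le k$ (invariant under all permutations of these indeterminates), $\Lambda_{m,k}^r$ its homogeneous part of degree $r$. Projections: $h_{m+1,k}:\Lambda_{m+1,k}\to\Lambda_{m,k}$ sets $\mathbf a_{(m+1)\mu_1\dots\mu_d}=0$ for all $0\le d\le k$ and all $\mu_i$; $v_{m,k+1}:\Lambda_{m,k+1}\to\Lambda_{m,k}$ sets $\mathbf a_{p\mu_1\dots\mu_{k+1}}=0$ for all $1\le p\le m$ and all $\mu_i$. For $1\le m_1\le m_2$ and $0\le k_1\le k_2$: $\phi_{(m_2,m_1),k}=h_{m_1+1,k}\circ\dots\circ h_{m_2,k}:\Lambda_{m_2,k}\to\Lambda_{m_1,k}$ and $\psi_{m,(k_2,k_1)}=v_{m,k_1+1}\circ\dots\circ v_{m,k_2}:\Lambda_{m,k_2}\to\Lambda_{m,k_1}$ (identities when the two indices agree). Limits: $\Lambda_{\cdot,k}=\bigoplus_r\varprojlim_m\Lambda^r_{m,k}$ (along the $h$'s, $m\geq 1$) and $\Lambda_{m,\cdot}=\bigoplus_r\varprojlim_k\Lambda^r_{m,k}$ (along the $v$'s, $k\geq 0$),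 realized as compatible sequences, with canonical projections $H_{m,k}:\Lambda_{\cdot,k}\to\Lambda_{m,k}$ and $V_{m,k}:\Lambda_{m,\cdot}\to\Lambda_{m,k}$. The maps $\phi_{(m_2,m_1)}:\Lambda_{m_2,\cdot}\to\Lambda_{m_1,\cdot}$ and $\psi_{(k_2,k_1)}:\Lambda_{\cdot,k_2}\to\Lambda_{\cdot,k_1}$ are obtained by applying $\phi_{(m_2,m_1),k}$, respectively $\psi_{m,(k_2,k_1)}$, to each term of a compatible sequence. $\Lambda$ is the graded ring of symmetric functions over $\mathbb Z$ in all the indeterminates $\mathbf a_{p\mu_1\dots\mu_d}$ ($p\ge1$, $d\ge0$), i.e. the common inverse limit, in graded rings, of the $\Lambda_{m,\cdot}$ and of the $\Lambda_{\cdot,k}$; $H_m:\Lambda\to\Lambda_{m,\cdot}$ sets to zero all indeterminates with $p>m$, and $V_k:\Lambda\to\Lambda_{\cdot,k}$ sets to zero all indeterminates with $d>k$. Arrows of the diagram. Horizontal: top row $H_{m+p}$, $\phi_{(m+p,m)}$, $\phi_{(m,m-1)}$; in the row of second index $l\in\{k+q,k,k-1\}$: $H_{m+p,l}$, $\phi_{(m+p,m),l}$, $\phi_{(m,m-1),l}=h_{m,l}$. Vertical: leftmost column $V_{k+q}$, $\psi_{(k+q,k)}$, $\psi_{(k,k-1)}$; in the column of first index $j\in\{m+p,m,m-1\}$: $V_{j,k+q}$, $\psi_{j,(k+q,k)}$, $\psi_{j,(k,k-1)}=v_{j,k}$. -}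

module Defs where

open import Algebra.Bundles using (CommutativeRing)
open import Algebra.Morphism.Structures using (IsRingHomomorphism)
open import Data.Fin.Base using (Fin; toℕ) renaming (zero to fzero; suc to fsuc)
open import Data.Maybe.Base using (Maybe; just; nothing; maybe′)
open import Data.Nat.Base using (ℕ; zero; suc; z≤n; s≤s; _≤_; _⊔_; _≤′_; ≤′-reflexive; ≤′-step)
  renaming (_+_ to _ℕ+_)
import Data.Nat.Properties as ℕₚ
open import Data.Product.Base using (Σ; ∃; _×_; _,_; proj₁; proj₂)
open import Data.Sum.Base using (_⊎_; inj₁; inj₂)
open import Data.Vec.Base using (Vec)
open import Function.Base using (_∘′_)
open import Function.Bundles using (_↔_; Inverse; mk↔ₛ′)
open import Level using (0ℓ)
open import Relation.Binary.PropositionalEquality.Core as ≡ using (_≡_)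
open import Relation.Nullary.Decidable using (yes; no)
open import Relation.Nullary.Negation using (contradiction-irr)

CRing : Set₁
CRing = CommutativeRing 0ℓ 0ℓ

module Summation (R : CRing) where
  open CommutativeRing R
  open import Algebra.Properties.CommutativeMonoid.Sum +-commutativeMonoid public
    using (sum; sum-cong-≋; sum-replicate-zero; ∑-distrib-+)

RingHom : (R S : CRing) → (CommutativeRing.Carrier R → CommutativeRing.Carrier S) → Set
RingHom R S = IsRingHomomorphism (CommutativeRing.rawRing R) (CommutativeRing.rawRing S)

module _ {R S : CRing} where
  private
    module R = CommutativeRing R
    module S = CommutativeRing S

  mkRingHom : {f : R.Carrier → S.Carrier} →
              (∀ {x y} → x R.≈ y → f x S.≈ f y) →
              f R.0# S.≈ S.0# →
              f R.1# S.≈ S.1# →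
              (∀ x y → f (x R.+ y) S.≈ f x S.+ f y) →
              (∀ x y → f (x R.* y) S.≈ f x S.* f y) →
              (∀ x → f (R.- x) S.≈ S.- f x) →
              RingHom R S f
  mkRingHom f-cong f-0 f-1 f-+ f-* f-neg = record
    { isSemiringHomomorphism = record
      { isNearSemiringHomomorphism = record
        { +-isMonoidHomomorphism = record
          { isMagmaHomomorphism = record
            { isRelHomomorphism = record { cong = f-cong }
            ; homo = f-+
            }
          ; ε-homo = f-0
          }
        ; *-homo = f-*
        }
      ; 1#-homo = f-1
      }
    ; -‿homo = f-neg
    }

  hom-sum : ∀ {f} → RingHom R S f → ∀ {N} (c : Fin N → R.Carrier) →
            f (Summation.sum R c) S.≈ Summation.sum S (λ i → f (c i))
  hom-sum h {zero}  c = IsRingHomomorphism.0#-homo h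
  hom-sum h {suc N} c = S.trans (IsRingHomomorphism.+-homo h _ _)
    (S.+-cong S.refl (hom-sum h (λ i → c (fsuc i))))

idRingHom : ∀ R → RingHom R R (λ x → x)
idRingHom R = mkRingHom {R} {R} (λ e → e) refl refl
  (λ _ _ → refl) (λ _ _ → refl) (λ _ → refl)
  where open CommutativeRing R

∘RingHom : ∀ R S T {f g} → RingHom R S f → RingHom S T g → RingHom R T (g ∘′ f)
∘RingHom R S T F G = mkRingHom {R} {T}
  (λ e → G.⟦⟧-cong (F.⟦⟧-cong e))
  (trans (G.⟦⟧-cong F.0#-homo) G.0#-homo)
  (trans (G.⟦⟧-cong F.1#-homo) G.1#-homo)
  (λ x y → trans (G.⟦⟧-cong (F.+-homo x y)) (G.+-homo _ _))
  (λ x y → trans (G.⟦⟧-cong (F.*-homo x y)) (G.*-homo _ _))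
  (λ x → trans (G.⟦⟧-cong (F.-‿homo x)) (G.-‿homo _))
  where
  open CommutativeRing T using (trans)
  module F = IsRingHomomorphism F
  module G = IsRingHomomorphism G

module _ {I : Set} (R : I → CRing) where
  private module R i = CommutativeRing (R i)

  productRing : CRing
  productRing = record
    { Carrier = ∀ i → R.Carrier i
    ; _≈_ = λ x y → ∀ i → R._≈_ i (x i) (y i)
    ; _+_ = λ x y i → R._+_ i (x i) (y i)
    ; _*_ = λ x y i → R._*_ i (x i) (y i)
    ; -_ = λ x i → R.-_ i (x i)
    ; 0# = λ i → R.0# i
    ; 1# = λ i → R.1# i
    ; isCommutativeRing = record
      { isRing = record
        { +-isAbelianGroup = record
          { isGroup = record
            { isMonoid = record
              { isSemigroup = record
                { isMagma = record
                  { isEquivalence = record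
                    { refl = λ i → R.refl i
                    ; sym = λ e i → R.sym i (e i)
                    ; trans = λ e e′ i → R.trans i (e i) (e′ i)
                    }
                  ; ∙-cong = λ e e′ i → R.+-cong i (e i) (e′ i)
                  }
                ; assoc = λ x y z i → R.+-assoc i (x i) (y i) (z i)
                }
              ; identity = (λ x i → R.+-identityˡ i (x i)) , (λ x i → R.+-identityʳ i (x i))
              }
            ; inverse = (λ x i → R.-‿inverseˡ i (x i)) , (λ x i → R.-‿inverseʳ i (x i))
            ; ⁻¹-cong = λ e i → R.-‿cong i (e i)
            }
          ; comm = λ x y i → R.+-comm i (x i) (y i)
          }
        ; *-cong = λ e e′ i → R.*-cong i (e i) (e′ i)
        ; *-assoc = λ x y z i → R.*-assoc i (x i) (y i) (z i)
        ; *-identity = (λ x i → R.*-identityˡ i (x i)) , (λ x i → R.*-identityʳ i (x i))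
        ; distrib = (λ x y z i → R.distribˡ i (x i) (y i) (z i))
                  , (λ x y z i → R.distribʳ i (x i) (y i) (z i))
        }
      ; *-comm = λ x y i → R.*-comm i (x i) (y i)
      }
    }

-- The subring cut out by P; membership proofs do not matter for equality.
module _ (R : CRing) where
  open CommutativeRing R

  subring : (P : Carrier → Set) → P 0# → P 1# →
            (∀ {x y} → P x → P y → P (x + y)) →
            (∀ {x y} → P x → P y → P (x * y)) →
            (∀ {x} → P x → P (- x)) → CRing
  subring P P0 P1 P+ P* P- = record
    { Carrier = Σ Carrier P
    ; _≈_ = λ x y → proj₁ x ≈ proj₁ y
    ; _+_ = λ x y → proj₁ x + proj₁ y , P+ (proj₂ x) (proj₂ y)
    ; _*_ = λ x y → proj₁ x * proj₁ y , P* (proj₂ x) (proj₂ y)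
    ; -_ = λ x → - proj₁ x , P- (proj₂ x)
    ; 0# = 0# , P0
    ; 1# = 1# , P1
    ; isCommutativeRing = record
      { isRing = record
        { +-isAbelianGroup = record
          { isGroup = record
            { isMonoid = record
              { isSemigroup = record
                { isMagma = record
                  { isEquivalence = record { refl = refl ; sym = sym ; trans = trans }
                  ; ∙-cong = +-cong
                  }
                ; assoc = λ x y z → +-assoc (proj₁ x) (proj₁ y) (proj₁ z)
                }
              ; identity = (λ x → +-identityˡ (proj₁ x)) , (λ x → +-identityʳ (proj₁ x))
              }
            ; inverse = (λ x → -‿inverseˡ (proj₁ x)) , (λ x → -‿inverseʳ (proj₁ x))
            ; ⁻¹-cong = -‿cong
            }
          ; comm = λ x y → +-comm (proj₁ x) (proj₁ y)
          }
        ; *-cong = *-cong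
        ; *-assoc = λ x y z → *-assoc (proj₁ x) (proj₁ y) (proj₁ z)
        ; *-identity = (λ x → *-identityˡ (proj₁ x)) , (λ x → *-identityʳ (proj₁ x))
        ; distrib = (λ x y z → distribˡ (proj₁ x) (proj₁ y) (proj₁ z))
                  , (λ x y z → distribʳ (proj₁ x) (proj₁ y) (proj₁ z))
        }
      ; *-comm = λ x y → *-comm (proj₁ x) (proj₁ y)
      }
    }

module _ (R : CRing) where
  open CommutativeRing R

  data HomogeneousSum (Homogeneous : ℕ → Carrier → Set) : Carrier → Set where
    single : ∀ {r x} → Homogeneous r x → HomogeneousSum Homogeneous x
    plus   : ∀ {x y} → HomogeneousSum Homogeneous x → HomogeneousSum Homogeneous y →
             HomogeneousSum Homogeneous (x + y)
    resp   : ∀ {x y} → x ≈ y → HomogeneousSum Homogeneous x → HomogeneousSum Homogeneous y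

-- R = ⨁ᵣ Rʳ as an internal direct sum of subgroups with Rʳ Rˢ ⊆ Rʳ⁺ˢ.
record GradedRing : Set₁ where
  field
    commutativeRing : CRing
  open CommutativeRing commutativeRing public
  open Summation commutativeRing public
  field
    Homogeneous      : ℕ → Carrier → Set
    homogeneous-resp : ∀ {r x y} → x ≈ y → Homogeneous r x → Homogeneous r y
    homogeneous-0    : ∀ {r} → Homogeneous r 0#
    homogeneous-+    : ∀ {r x y} → Homogeneous r x → Homogeneous r y → Homogeneous r (x + y)
    homogeneous-neg  : ∀ {r x} → Homogeneous r x → Homogeneous r (- x)
    homogeneous-1    : Homogeneous 0 1#
    homogeneous-*    : ∀ {r s x y} → Homogeneous r x → Homogeneous s y →
                       Homogeneous (r ℕ+ s) (x * y)
    decompose        : ∀ x → HomogeneousSum commutativeRing Homogeneous x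
    independent      : ∀ {N} (c : Fin N → Carrier) → (∀ r → Homogeneous (toℕ r) (c r)) →
                       sum c ≈ 0# → ∀ r → c r ≈ 0#

record GradedHom (A B : GradedRing) : Set where
  private
    module A = GradedRing A
    module B = GradedRing B
  field
    ⟦_⟧             : A.Carrier → B.Carrier
    isRingHom       : RingHom A.commutativeRing B.commutativeRing ⟦_⟧
    preservesDegree : ∀ {r x} → A.Homogeneous r x → B.Homogeneous r ⟦ x ⟧
  open IsRingHomomorphism isRingHom public

open GradedHom public using (⟦_⟧)

idHom : ∀ {A} → GradedHom A A
idHom {A} = record
  { ⟦_⟧ = λ x → x
  ; isRingHom = idRingHom (GradedRing.commutativeRing A)
  ; preservesDegree = λ h → h
  }

infixr 9 _∘ᴳ_

_∘ᴳ_ : ∀ {A B C} → GradedHom B C → GradedHom A B → GradedHom A C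
_∘ᴳ_ {A} {B} {C} g f = record
  { ⟦_⟧ = ⟦ g ⟧ ∘′ ⟦ f ⟧
  ; isRingHom = ∘RingHom (GradedRing.commutativeRing A) (GradedRing.commutativeRing B)
      (GradedRing.commutativeRing C) (GradedHom.isRingHom f) (GradedHom.isRingHom g)
  ; preservesDegree = λ h → GradedHom.preservesDegree g (GradedHom.preservesDegree f h)
  }

infix 4 _≐_

_≐_ : ∀ {A B} → GradedHom A B → GradedHom A B → Set
_≐_ {A} {B} f g = ∀ x → ⟦ f ⟧ x ≈ ⟦ g ⟧ x
  where open GradedRing B

record _≅_ (A B : GradedRing) : Set where
  field
    to      : GradedHom A B
    from    : GradedHom B A
    to∘from : to ∘ᴳ from ≐ idHom
    from∘to : from ∘ᴳ to ≐ idHom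

Commutes : ∀ {A B C D} (top : GradedHom A B) (left : GradedHom A C)
           (right : GradedHom B D) (bottom : GradedHom C D) → Set
Commutes top left right bottom = right ∘ᴳ top ≐ bottom ∘ᴳ left

hom-HomogeneousSum : ∀ {R S : CRing} {P Q f} → RingHom R S f →
  (∀ {r x} → P r x → Q r (f x)) → ∀ {x} → HomogeneousSum R P x → HomogeneousSum S Q (f x)
hom-HomogeneousSum h t (single p) = single (t p)
hom-HomogeneousSum {R} {S} h t (plus a b) =
  resp (CommutativeRing.sym S (IsRingHomomorphism.+-homo h _ _))
       (plus (hom-HomogeneousSum h t a) (hom-HomogeneousSum h t b))
hom-HomogeneousSum h t (resp e a) =
  resp (IsRingHomomorphism.⟦⟧-cong h e) (hom-HomogeneousSum h t a)

record Diagram : Set₁ where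
  field
    Vertex Edge : Set
    src tgt     : Edge → Vertex
    obj         : Vertex → GradedRing
    arr         : ∀ e → GradedHom (obj (src e)) (obj (tgt e))

-- ⨁ᵣ lim Gᵢʳ, realised inside lim Gᵢ: compatible families which are finite
-- sums of compatible families of homogeneous elements.  (The sum is direct
-- because it is so in each Gᵢ.)
module _ (D : Diagram) where
  open Diagram D
  private module G i = GradedRing (obj i)

  Family : Set
  Family = ∀ i → G.Carrier i

  Compatible : Family → Set
  Compatible x = ∀ e → G._≈_ (tgt e) (⟦ arr e ⟧ (x (src e))) (x (tgt e))

  private
    Π : CRing
    Π = productRing (λ i → G.commutativeRing i)

  compatibleRing : CRing
  compatibleRing = subring Π Compatible
    (λ e → GradedHom.0#-homo (arr e))
    (λ e → GradedHom.1#-homo (arr e))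
    (λ p q e → G.trans _ (GradedHom.+-homo (arr e) _ _) (G.+-cong _ (p e) (q e)))
    (λ p q e → G.trans _ (GradedHom.*-homo (arr e) _ _) (G.*-cong _ (p e) (q e)))
    (λ p e → G.trans _ (GradedHom.-‿homo (arr e) _) (G.-‿cong _ (p e)))

  private module C = CommutativeRing compatibleRing

  CompatibleOfDegree : ℕ → C.Carrier → Set
  CompatibleOfDegree r x = ∀ i → G.Homogeneous i r (proj₁ x i)

  private
    Sums : C.Carrier → Set
    Sums = HomogeneousSum compatibleRing CompatibleOfDegree

    sums-* : ∀ {x y} → Sums x → Sums y → Sums (x C.* y)
    sums-* (resp {x} {x′} e a) b =
      resp {x = x C.* _} {y = x′ C.* _} (λ i → G.*-cong i (e i) (G.refl i)) (sums-* a b)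
    sums-* {y = y} (plus {x₁} {x₂} a b) d =
      resp {x = (x₁ C.* y) C.+ (x₂ C.* y)} {y = (x₁ C.+ x₂) C.* y}
        (λ i → G.sym i (G.distribʳ i _ _ _)) (plus (sums-* a d) (sums-* b d))
    sums-* {x = x} a@(single _) (plus {y₁} {y₂} b d) =
      resp {x = (x C.* y₁) C.+ (x C.* y₂)} {y = x C.* (y₁ C.+ y₂)}
        (λ i → G.sym i (G.distribˡ i _ _ _)) (plus (sums-* a b) (sums-* a d))
    sums-* {x = x} a@(single _) (resp {y} {y′} e b) =
      resp {x = x C.* y} {y = x C.* y′} (λ i → G.*-cong i (G.refl i) (e i)) (sums-* a b)
    sums-* (single p) (single q) = single (λ i → G.homogeneous-* i (p i) (q i))

    sums-neg : ∀ {x} → Sums x → Sums (C.- x)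
    sums-neg (single p) = single (λ i → G.homogeneous-neg i (p i))
    sums-neg (plus {x} {y} a b) =
      resp {x = (C.- x) C.+ (C.- y)} {y = C.- (x C.+ y)}
        (λ i → -‿+-comm i (proj₁ x i) (proj₁ y i))
        (plus (sums-neg a) (sums-neg b))
      where
      -‿+-comm : ∀ i x y → G._≈_ i (G._+_ i (G.-_ i x) (G.-_ i y)) (G.-_ i (G._+_ i x y))
      -‿+-comm i = P.-‿+-comm
        where import Algebra.Properties.Ring (CommutativeRing.ring (G.commutativeRing i)) as P
    sums-neg (resp {x} {y} e a) =
      resp {x = C.- x} {y = C.- y} (λ i → G.-‿cong i (e i)) (sums-neg a)

    limRing : CRing
    limRing = subring compatibleRing Sums
      (single {r = 0} (λ i → G.homogeneous-0 i))
      (single (λ i → G.homogeneous-1 i))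
      plus sums-* sums-neg

    LimHomogeneous : ℕ → CommutativeRing.Carrier limRing → Set
    LimHomogeneous r x = CompatibleOfDegree r (proj₁ x)

    lim-decompose : ∀ {x} (a : Sums x) → HomogeneousSum limRing LimHomogeneous (x , a)
    lim-decompose (single p) = single p
    lim-decompose (plus a b) = resp (λ i → G.refl i) (plus (lim-decompose a) (lim-decompose b))
    lim-decompose (resp e a) = resp e (lim-decompose a)

    component-isRingHom : ∀ i → RingHom limRing (G.commutativeRing i) (λ x → proj₁ (proj₁ x) i)
    component-isRingHom i = mkRingHom {limRing} {G.commutativeRing i}
      (λ e → e i) (G.refl i) (G.refl i)
      (λ _ _ → G.refl i) (λ _ _ → G.refl i) (λ _ → G.refl i)

  Lim : GradedRing
  Lim = record
    { commutativeRing = limRing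
    ; Homogeneous = LimHomogeneous
    ; homogeneous-resp = λ e p i → G.homogeneous-resp i (e i) (p i)
    ; homogeneous-0 = λ i → G.homogeneous-0 i
    ; homogeneous-+ = λ p q i → G.homogeneous-+ i (p i) (q i)
    ; homogeneous-neg = λ p i → G.homogeneous-neg i (p i)
    ; homogeneous-1 = λ i → G.homogeneous-1 i
    ; homogeneous-* = λ p q i → G.homogeneous-* i (p i) (q i)
    ; decompose = λ x → lim-decompose (proj₂ x)
    ; independent = λ c p e r i →
        G.independent i (λ s → proj₁ (proj₁ (c s)) i) (λ s → p s i)
          (G.trans i (G.sym i (hom-sum {limRing} {G.commutativeRing i} (component-isRingHom i) c)) (e i)) r
    }

  π : ∀ i → GradedHom Lim (obj i)
  π i = record
    { ⟦_⟧ = λ x → proj₁ (proj₁ x) i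
    ; isRingHom = component-isRingHom i
    ; preservesDegree = λ p → p i
    }

  π-compatible : ∀ e → arr e ∘ᴳ π (src e) ≐ π (tgt e)
  π-compatible e x = proj₂ (proj₁ x) e

  lift : ∀ {T} (f : ∀ i → GradedHom T (obj i)) →
         (∀ e → arr e ∘ᴳ f (src e) ≐ f (tgt e)) → GradedHom T Lim
  lift {T} f comp = record
    { ⟦_⟧ = λ x → cmp x , hom-HomogeneousSum cmp-isRingHom cmp-degree (T.decompose x)
    ; isRingHom = mkRingHom {T.commutativeRing} {limRing}
        (λ e i → F.⟦⟧-cong i e) (λ i → F.0#-homo i) (λ i → F.1#-homo i)
        (λ x y i → F.+-homo i x y) (λ x y i → F.*-homo i x y) (λ x i → F.-‿homo i x)
    ; preservesDegree = cmp-degree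
    }
    where
    module T = GradedRing T
    module F i = GradedHom (f i)
    cmp : T.Carrier → C.Carrier
    cmp x = (λ i → ⟦ f i ⟧ x) , (λ e → comp e x)
    cmp-isRingHom : RingHom T.commutativeRing compatibleRing cmp
    cmp-isRingHom = mkRingHom {T.commutativeRing} {compatibleRing}
        (λ e i → F.⟦⟧-cong i e) (λ i → F.0#-homo i) (λ i → F.1#-homo i)
        (λ x y i → F.+-homo i x y) (λ x y i → F.*-homo i x y) (λ x i → F.-‿homo i x)
    cmp-degree : ∀ {r x} → T.Homogeneous r x → CompatibleOfDegree r (cmp x)
    cmp-degree p i = F.preservesDegree i p

-- R[[t]], used to extract homogeneous components.
module PowerSeries (R : CRing) where
  open CommutativeRing R
  open import Relation.Binary.Reasoning.Setoid setoid
  open import Algebra.Properties.CommutativeSemigroup +-commutativeSemigroup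
    using (interchange; x∙yz≈y∙xz)

  private
    module A = CommutativeRing (productRing {ℕ} (λ _ → R))

  Series : Set
  Series = ℕ → Carrier

  tail : Series → Series
  tail f t = f (suc t)

  conv : Series → Series → Series
  conv f g zero    = f 0 * g 0
  conv f g (suc t) = f 0 * g (suc t) + conv (tail f) g t

  monomial : ℕ → Carrier → Series
  monomial zero    x zero    = x
  monomial zero    x (suc t) = 0#
  monomial (suc r) x zero    = 0#
  monomial (suc r) x (suc t) = monomial r x t

  conv-cong : ∀ {f f′ g g′} → f A.≈ f′ → g A.≈ g′ → conv f g A.≈ conv f′ g′
  conv-cong e e′ zero    = *-cong (e 0) (e′ 0)
  conv-cong e e′ (suc t) = +-cong (*-cong (e 0) (e′ (suc t))) (conv-cong (λ s → e (suc s)) e′ t)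

  conv-zeroˡ : ∀ {f} g → (∀ t → f t ≈ 0#) → ∀ t → conv f g t ≈ 0#
  conv-zeroˡ g z zero    = trans (*-congʳ (z 0)) (zeroˡ _)
  conv-zeroˡ g z (suc t) = trans
    (+-cong (trans (*-congʳ (z 0)) (zeroˡ _)) (conv-zeroˡ g (λ s → z (suc s)) t))
    (+-identityˡ 0#)

  conv-suc : ∀ f g t → conv f g (suc t) ≈ f (suc t) * g 0 + conv f (tail g) t
  conv-suc f g zero    = +-comm _ _
  conv-suc f g (suc t) = begin
    f 0 * g (suc (suc t)) + conv (tail f) g (suc t)
      ≈⟨ +-congˡ (conv-suc (tail f) g t) ⟩
    f 0 * g (suc (suc t)) + (f (suc (suc t)) * g 0 + conv (tail f) (tail g) t)
      ≈⟨ x∙yz≈y∙xz _ _ _ ⟩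
    f (suc (suc t)) * g 0 + (f 0 * g (suc (suc t)) + conv (tail f) (tail g) t) ∎

  conv-comm : ∀ f g t → conv f g t ≈ conv g f t
  conv-comm f g zero    = *-comm _ _
  conv-comm f g (suc t) = begin
    f 0 * g (suc t) + conv (tail f) g t ≈⟨ +-cong (*-comm _ _) (conv-comm (tail f) g t) ⟩
    g (suc t) * f 0 + conv g (tail f) t ≈⟨ conv-suc g f t ⟨
    conv g f (suc t) ∎

  conv-distribʳ : ∀ h f g t → conv (f A.+ g) h t ≈ conv f h t + conv g h t
  conv-distribʳ h f g zero    = distribʳ _ _ _
  conv-distribʳ h f g (suc t) = begin
    (f 0 + g 0) * h (suc t) + conv (tail f A.+ tail g) h t
      ≈⟨ +-cong (distribʳ _ _ _) (conv-distribʳ h (tail f) (tail g) t) ⟩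
    (f 0 * h (suc t) + g 0 * h (suc t)) + (conv (tail f) h t + conv (tail g) h t)
      ≈⟨ interchange _ _ _ _ ⟩
    conv f h (suc t) + conv g h (suc t) ∎

  conv-distribˡ : ∀ h f g t → conv h (f A.+ g) t ≈ conv h f t + conv h g t
  conv-distribˡ h f g t = begin
    conv h (f A.+ g) t      ≈⟨ conv-comm h (f A.+ g) t ⟩
    conv (f A.+ g) h t      ≈⟨ conv-distribʳ h f g t ⟩
    conv f h t + conv g h t ≈⟨ +-cong (conv-comm f h t) (conv-comm g h t) ⟩
    conv h f t + conv h g t ∎

  conv-scale : ∀ c f g t → conv (λ s → c * f s) g t ≈ c * conv f g t
  conv-scale c f g zero    = *-assoc _ _ _
  conv-scale c f g (suc t) =
    trans (+-cong (*-assoc _ _ _) (conv-scale c (tail f) g t)) (sym (distribˡ _ _ _))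

  conv-assoc : ∀ f g h t → conv (conv f g) h t ≈ conv f (conv g h) t
  conv-assoc f g h zero    = *-assoc _ _ _
  conv-assoc f g h (suc t) = begin
    f 0 * g 0 * h (suc t) + conv ((λ s → f 0 * tail g s) A.+ conv (tail f) g) h t
      ≈⟨ +-cong (*-assoc _ _ _) (conv-distribʳ h _ _ t) ⟩
    f 0 * (g 0 * h (suc t)) + (conv (λ s → f 0 * tail g s) h t + conv (conv (tail f) g) h t)
      ≈⟨ +-congˡ (+-cong (conv-scale (f 0) (tail g) h t) (conv-assoc (tail f) g h t)) ⟩
    f 0 * (g 0 * h (suc t)) + (f 0 * conv (tail g) h t + conv (tail f) (conv g h) t)
      ≈⟨ +-assoc _ _ _ ⟨
    (f 0 * (g 0 * h (suc t)) + f 0 * conv (tail g) h t) + conv (tail f) (conv g h) t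
      ≈⟨ +-congʳ (distribˡ _ _ _) ⟨
    conv f (conv g h) (suc t) ∎

  conv-identityˡ : ∀ g t → conv (monomial 0 1#) g t ≈ g t
  conv-identityˡ g zero    = *-identityˡ _
  conv-identityˡ g (suc t) =
    trans (+-cong (*-identityˡ _) (conv-zeroˡ g (λ _ → refl) t)) (+-identityʳ _)

  series : CRing
  series = record
    { Carrier = Series
    ; _≈_ = A._≈_
    ; _+_ = A._+_
    ; _*_ = conv
    ; -_ = A.-_
    ; 0# = A.0#
    ; 1# = monomial 0 1#
    ; isCommutativeRing = record
      { isRing = record
        { +-isAbelianGroup = A.+-isAbelianGroup
        ; *-cong = conv-cong
        ; *-assoc = conv-assoc
        ; *-identity = conv-identityˡ , λ g t → trans (conv-comm g _ t) (conv-identityˡ g t)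
        ; distrib = conv-distribˡ , conv-distribʳ
        }
      ; *-comm = conv-comm
      }
    }

  monomial-cong : ∀ r {x y} → x ≈ y → monomial r x A.≈ monomial r y
  monomial-cong zero    e zero    = e
  monomial-cong zero    e (suc t) = refl
  monomial-cong (suc r) e zero    = refl
  monomial-cong (suc r) e (suc t) = monomial-cong r e t

  monomial-0 : ∀ r t → monomial r 0# t ≈ 0#
  monomial-0 zero    zero    = refl
  monomial-0 zero    (suc t) = refl
  monomial-0 (suc r) zero    = refl
  monomial-0 (suc r) (suc t) = monomial-0 r t

  monomial-+ : ∀ r x y t → monomial r (x + y) t ≈ monomial r x t + monomial r y t
  monomial-+ zero    x y zero    = refl
  monomial-+ zero    x y (suc t) = sym (+-identityˡ _)
  monomial-+ (suc r) x y zero    = sym (+-identityˡ _)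
  monomial-+ (suc r) x y (suc t) = monomial-+ r x y t

  monomial-neg : ∀ r x t → monomial r (- x) t ≈ - monomial r x t
  monomial-neg r x t = uniqueʳ _ _ (begin
    monomial r x t + monomial r (- x) t ≈⟨ monomial-+ r x (- x) t ⟨
    monomial r (x + - x) t              ≈⟨ monomial-cong r (-‿inverseʳ x) t ⟩
    monomial r 0# t                     ≈⟨ monomial-0 r t ⟩
    0#                                  ∎)
    where open import Algebra.Properties.AbelianGroup +-abelianGroup
            renaming (inverseʳ-unique to uniqueʳ)

  monomial-* : ∀ r s x y → conv (monomial r x) (monomial s y) A.≈ monomial (r ℕ+ s) (x * y)
  monomial-* zero zero    x y zero    = refl
  monomial-* zero (suc s) x y zero    = zeroʳ _
  monomial-* zero s       x y (suc t) =
    trans (+-cong (scale s (suc t)) (conv-zeroˡ _ (λ _ → refl) t)) (+-identityʳ _)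
    where
    scale : ∀ s t → x * monomial s y t ≈ monomial s (x * y) t
    scale zero    zero    = refl
    scale zero    (suc t) = zeroʳ _
    scale (suc s) zero    = zeroʳ _
    scale (suc s) (suc t) = scale s t
  monomial-* (suc r) s x y zero    = zeroˡ _
  monomial-* (suc r) s x y (suc t) =
    trans (+-cong (zeroˡ _) (monomial-* r s x y t)) (+-identityˡ _)

  open Summation R

  sum-monomial : ∀ {N} (c : Fin N → Carrier) j →
                 sum (λ i → monomial (toℕ i) (c i) (toℕ j)) ≈ c j
  sum-monomial {suc N} c fzero =
    trans (+-congˡ (sum-replicate-zero N)) (+-identityʳ _)
  sum-monomial {suc N} c (fsuc j) =
    trans (+-identityˡ _) (sum-monomial (λ i → c (fsuc i)) j)

  sum-coefficients : ∀ r x N → suc r ≤ N → sum {N} (λ i → monomial r x (toℕ i)) ≈ x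
  sum-coefficients zero    x (suc N) _       =
    trans (+-congˡ (sum-replicate-zero N)) (+-identityʳ _)
  sum-coefficients (suc r) x (suc N) (s≤s l) =
    trans (+-identityˡ _) (sum-coefficients r x N l)

-- ℤ[X], as the free commutative ring on X.
module _ (X : Set) where

  infix  8 ⊝_
  infixl 7 _⊗_
  infixl 6 _⊕_
  infix  4 _≋_

  data Poly : Set where
    var     : X → Poly
    𝟎 𝟏     : Poly
    _⊕_ _⊗_ : Poly → Poly → Poly
    ⊝_      : Poly → Poly

  data _≋_ : Poly → Poly → Set where
    ≋-refl     : ∀ {f} → f ≋ f
    ≋-sym      : ∀ {f g} → f ≋ g → g ≋ f
    ≋-trans    : ∀ {f g h} → f ≋ g → g ≋ h → f ≋ h
    ⊕-cong     : ∀ {f f′ g g′} → f ≋ f′ → g ≋ g′ → f ⊕ g ≋ f′ ⊕ g′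
    ⊗-cong     : ∀ {f f′ g g′} → f ≋ f′ → g ≋ g′ → f ⊗ g ≋ f′ ⊗ g′
    ⊝-cong     : ∀ {f f′} → f ≋ f′ → ⊝ f ≋ ⊝ f′
    ⊕-assoc    : ∀ f g h → (f ⊕ g) ⊕ h ≋ f ⊕ (g ⊕ h)
    ⊕-comm     : ∀ f g → f ⊕ g ≋ g ⊕ f
    ⊕-identity : ∀ f → 𝟎 ⊕ f ≋ f
    ⊕-inverse  : ∀ f → ⊝ f ⊕ f ≋ 𝟎
    ⊗-assoc    : ∀ f g h → (f ⊗ g) ⊗ h ≋ f ⊗ (g ⊗ h)
    ⊗-comm     : ∀ f g → f ⊗ g ≋ g ⊗ f
    ⊗-identity : ∀ f → 𝟏 ⊗ f ≋ f
    ⊗-distrib  : ∀ f g h → f ⊗ (g ⊕ h) ≋ f ⊗ g ⊕ f ⊗ h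

  polyRing : CRing
  polyRing = record
    { Carrier = Poly
    ; _≈_ = _≋_
    ; _+_ = _⊕_
    ; _*_ = _⊗_
    ; -_ = ⊝_
    ; 0# = 𝟎
    ; 1# = 𝟏
    ; isCommutativeRing = record
      { isRing = record
        { +-isAbelianGroup = record
          { isGroup = record
            { isMonoid = record
              { isSemigroup = record
                { isMagma = record
                  { isEquivalence = record { refl = ≋-refl ; sym = ≋-sym ; trans = ≋-trans }
                  ; ∙-cong = ⊕-cong
                  }
                ; assoc = ⊕-assoc
                }
              ; identity = ⊕-identity , λ f → ≋-trans (⊕-comm f 𝟎) (⊕-identity f)
              }
            ; inverse = ⊕-inverse , λ f → ≋-trans (⊕-comm f (⊝ f)) (⊕-inverse f)
            ; ⁻¹-cong = ⊝-cong
            }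
          ; comm = ⊕-comm
          }
        ; *-cong = ⊗-cong
        ; *-assoc = ⊗-assoc
        ; *-identity = ⊗-identity , λ f → ≋-trans (⊗-comm f 𝟏) (⊗-identity f)
        ; distrib = ⊗-distrib , λ h f g → ≋-trans (⊗-comm (f ⊕ g) h)
            (≋-trans (⊗-distrib h f g) (⊕-cong (⊗-comm h f) (⊗-comm h g)))
        }
      ; *-comm = ⊗-comm
      }
    }

  -- Homogeneous polynomials of degree r, the integers having degree 0 and
  -- every indeterminate degree 1.
  data PolyHomogeneous : ℕ → Poly → Set where
    hom-var  : ∀ {x} → PolyHomogeneous 1 (var x)
    hom-𝟎    : ∀ {r} → PolyHomogeneous r 𝟎
    hom-𝟏    : PolyHomogeneous 0 𝟏
    hom-⊕    : ∀ {r f g} → PolyHomogeneous r f → PolyHomogeneous r g → PolyHomogeneous r (f ⊕ g)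
    hom-⊝    : ∀ {r f} → PolyHomogeneous r f → PolyHomogeneous r (⊝ f)
    hom-⊗    : ∀ {r s f g} → PolyHomogeneous r f → PolyHomogeneous s g →
               PolyHomogeneous (r ℕ+ s) (f ⊗ g)
    hom-resp : ∀ {r f g} → f ≋ g → PolyHomogeneous r f → PolyHomogeneous r g

module _ {X : Set} (R : CRing) (ρ : X → CommutativeRing.Carrier R) where
  open CommutativeRing R

  eval : Poly X → Carrier
  eval (var x) = ρ x
  eval 𝟎       = 0#
  eval 𝟏       = 1#
  eval (f ⊕ g) = eval f + eval g
  eval (f ⊗ g) = eval f * eval g
  eval (⊝ f)   = - eval f

  eval-cong : ∀ {f g} → _≋_ X f g → eval f ≈ eval g
  eval-cong ≋-refl            = refl
  eval-cong (≋-sym e)         = sym (eval-cong e)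
  eval-cong (≋-trans e e′)    = trans (eval-cong e) (eval-cong e′)
  eval-cong (⊕-cong e e′)     = +-cong (eval-cong e) (eval-cong e′)
  eval-cong (⊗-cong e e′)     = *-cong (eval-cong e) (eval-cong e′)
  eval-cong (⊝-cong e)        = -‿cong (eval-cong e)
  eval-cong (⊕-assoc f g h)   = +-assoc _ _ _
  eval-cong (⊕-comm f g)      = +-comm _ _
  eval-cong (⊕-identity f)    = +-identityˡ _
  eval-cong (⊕-inverse f)     = -‿inverseˡ _
  eval-cong (⊗-assoc f g h)   = *-assoc _ _ _
  eval-cong (⊗-comm f g)      = *-comm _ _
  eval-cong (⊗-identity f)    = *-identityˡ _
  eval-cong (⊗-distrib f g h) = distribˡ _ _ _

  eval-isRingHom : RingHom (polyRing X) R eval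
  eval-isRingHom = mkRingHom {polyRing X} {R} eval-cong refl refl
    (λ _ _ → refl) (λ _ _ → refl) (λ _ → refl)

hom-unique : ∀ {X} (R : CRing) (let open CommutativeRing R) {φ ψ : Poly X → Carrier} →
  RingHom (polyRing X) R φ → RingHom (polyRing X) R ψ →
  (∀ x → φ (var x) ≈ ψ (var x)) → ∀ f → φ f ≈ ψ f
hom-unique {X} R {φ} {ψ} Φ Ψ e = go
  where
  open CommutativeRing R
  module Φ = IsRingHomomorphism Φ
  module Ψ = IsRingHomomorphism Ψ
  go : ∀ f → φ f ≈ ψ f
  go (var x) = e x
  go 𝟎 = trans Φ.0#-homo (sym Ψ.0#-homo)
  go 𝟏 = trans Φ.1#-homo (sym Ψ.1#-homo)
  go (f ⊕ g) = trans (Φ.+-homo f g) (trans (+-cong (go f) (go g)) (sym (Ψ.+-homo f g)))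
  go (f ⊗ g) = trans (Φ.*-homo f g) (trans (*-cong (go f) (go g)) (sym (Ψ.*-homo f g)))
  go (⊝ f) = trans (Φ.-‿homo f) (trans (-‿cong (go f)) (sym (Ψ.-‿homo f)))

substitute : ∀ {X Y} → (X → Poly Y) → Poly X → Poly Y
substitute {Y = Y} = eval (polyRing Y)

substitute-isRingHom : ∀ {X Y} (ρ : X → Poly Y) →
                       RingHom (polyRing X) (polyRing Y) (substitute ρ)
substitute-isRingHom {Y = Y} = eval-isRingHom (polyRing Y)

rename : ∀ {X Y} → (X → Y) → Poly X → Poly Y
rename u = substitute (λ x → var (u x))

rename-isRingHom : ∀ {X Y} (u : X → Y) → RingHom (polyRing X) (polyRing Y) (rename u)
rename-isRingHom u = substitute-isRingHom (λ x → var (u x))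

substitute-homogeneous : ∀ {X Y} (ρ : X → Poly Y) → (∀ x → PolyHomogeneous Y 1 (ρ x)) →
  ∀ {r f} → PolyHomogeneous X r f → PolyHomogeneous Y r (substitute ρ f)
substitute-homogeneous {X} {Y} ρ p = go
  where
  go : ∀ {r f} → PolyHomogeneous X r f → PolyHomogeneous Y r (substitute ρ f)
  go hom-var        = p _
  go hom-𝟎          = hom-𝟎
  go hom-𝟏          = hom-𝟏
  go (hom-⊕ a b)    = hom-⊕ (go a) (go b)
  go (hom-⊝ a)      = hom-⊝ (go a)
  go (hom-⊗ a b)    = hom-⊗ (go a) (go b)
  go (hom-resp e a) = hom-resp (eval-cong (polyRing Y) ρ e) (go a)

-- components f r is the homogeneous part of degree r: the coefficient of tʳ
-- after replacing every indeterminate x by x t.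
module Components (X : Set) where
  open CommutativeRing (polyRing X)
  open PowerSeries (polyRing X)
  open Summation (polyRing X)
  open import Relation.Binary.Reasoning.Setoid setoid

  components : Poly X → Series
  components = eval series (λ x → monomial 1 (var x))

  components-isRingHom : RingHom (polyRing X) series components
  components-isRingHom = eval-isRingHom series _

  components-cong : ∀ {f g} → f ≈ g → ∀ r → components f r ≈ components g r
  components-cong = eval-cong series _

  components-of-homogeneous : ∀ {r f} → PolyHomogeneous X r f →
                              ∀ t → components f t ≈ monomial r f t
  components-of-homogeneous hom-var t = refl
  components-of-homogeneous {r} hom-𝟎 t = sym (monomial-0 r t)
  components-of-homogeneous hom-𝟏 t = refl
  components-of-homogeneous {r} (hom-⊕ a b) t =
    trans (+-cong (components-of-homogeneous a t) (components-of-homogeneous b t))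
          (sym (monomial-+ r _ _ t))
  components-of-homogeneous {r} (hom-⊝ a) t =
    trans (-‿cong (components-of-homogeneous a t)) (sym (monomial-neg r _ t))
  components-of-homogeneous (hom-⊗ {r} {s} a b) t =
    trans (conv-cong (components-of-homogeneous a) (components-of-homogeneous b) t)
          (monomial-* r s _ _ t)
  components-of-homogeneous {r} (hom-resp e a) t =
    trans (components-cong (sym e) t)
          (trans (components-of-homogeneous a t) (monomial-cong r e t))

  Graded : Series → Set
  Graded u = ∀ r → PolyHomogeneous X r (u r)

  private
    graded-⊗ : ∀ {f g} r → (∀ i → PolyHomogeneous X (i ℕ+ r) (f i)) → Graded g →
               ∀ t → PolyHomogeneous X (t ℕ+ r) (conv f g t)
    graded-⊗ r a b zero = ≡.subst (λ s → PolyHomogeneous X s _) (ℕₚ.+-identityʳ r)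
      (hom-⊗ (a 0) (b 0))
    graded-⊗ {f} {g} r a b (suc t) = hom-⊕
      (≡.subst (λ s → PolyHomogeneous X s (f 0 * g (suc t))) (ℕₚ.+-comm r (suc t))
        (hom-⊗ (a 0) (b (suc t))))
      (≡.subst (λ s → PolyHomogeneous X s (conv (tail f) g t)) (ℕₚ.+-suc t r)
        (graded-⊗ (suc r)
          (λ i → ≡.subst (λ s → PolyHomogeneous X s (f (suc i))) (≡.sym (ℕₚ.+-suc i r))
            (a (suc i))) b t))

  components-graded : ∀ f → Graded (components f)
  components-graded (var x) zero          = hom-𝟎
  components-graded (var x) (suc zero)    = hom-var
  components-graded (var x) (suc (suc r)) = hom-𝟎
  components-graded 𝟎 r                   = hom-𝟎
  components-graded 𝟏 zero                = hom-𝟏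
  components-graded 𝟏 (suc r)             = hom-𝟎
  components-graded (f ⊕ g) r = hom-⊕ (components-graded f r) (components-graded g r)
  components-graded (⊝ f) r   = hom-⊝ (components-graded f r)
  components-graded (f ⊗ g) r =
    ≡.subst (λ s → PolyHomogeneous X s (conv (components f) (components g) r))
      (ℕₚ.+-identityʳ r)
      (graded-⊗ 0
        (λ i → ≡.subst (λ s → PolyHomogeneous X s (components f i)) (≡.sym (ℕₚ.+-identityʳ i))
          (components-graded f i))
        (components-graded g) r)

  components-independent : ∀ {N} (c : Fin N → Poly X) →
    (∀ r → PolyHomogeneous X (toℕ r) (c r)) → sum c ≈ 𝟎 → ∀ r → c r ≈ 𝟎
  components-independent c p e r = begin
    c r                                         ≈⟨ sum-monomial c r ⟨
    sum (λ i → monomial (toℕ i) (c i) (toℕ r))  ≈⟨ sum-cong-≋ (λ i → components-of-homogeneous (p i) (toℕ r)) ⟨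
    sum (λ i → components (c i) (toℕ r))        ≈⟨ sum-at (toℕ r) c ⟨
    components (sum c) (toℕ r)                  ≈⟨ components-cong e (toℕ r) ⟩
    𝟎                                           ∎
    where
    sum-at : ∀ t {N} (c : Fin N → Poly X) → components (sum c) t ≈ sum (λ i → components (c i) t)
    sum-at t {zero}  c = refl
    sum-at t {suc N} c = +-congˡ (sum-at t (λ i → c (fsuc i)))

  private
    Sums : Poly X → Set
    Sums = HomogeneousSum (polyRing X) (PolyHomogeneous X)

    sums-* : ∀ {f g} → Sums f → Sums g → Sums (f * g)
    sums-* (resp e a) b = resp (*-congʳ e) (sums-* a b)
    sums-* (plus a b) d = resp (sym (distribʳ _ _ _)) (plus (sums-* a d) (sums-* b d))
    sums-* a@(single _) (plus b d) = resp (sym (distribˡ _ _ _)) (plus (sums-* a b) (sums-* a d))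
    sums-* a@(single _) (resp e b) = resp (*-congˡ e) (sums-* a b)
    sums-* (single p) (single q) = single (hom-⊗ p q)

    sums-neg : ∀ {f} → Sums f → Sums (- f)
    sums-neg (single p) = single (hom-⊝ p)
    sums-neg (plus a b) = resp (-‿+-comm _ _) (plus (sums-neg a) (sums-neg b))
      where open import Algebra.Properties.Ring (CommutativeRing.ring (polyRing X)) using (-‿+-comm)
    sums-neg (resp e a) = resp (-‿cong e) (sums-neg a)

    sums : ∀ f → Sums f
    sums (var x) = single hom-var
    sums 𝟎       = single (hom-𝟎 {r = 0})
    sums 𝟏       = single hom-𝟏
    sums (f ⊕ g) = plus (sums f) (sums g)
    sums (f ⊗ g) = sums-* (sums f) (sums g)
    sums (⊝ f)   = sums-neg (sums f)

    bound : ∀ {f} → Sums f → ∃ λ N → ∀ M → N ≤ M → sum {M} (λ i → components f (toℕ i)) ≈ f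
    bound (single {r} p) = suc r , λ M l →
      trans (sum-cong-≋ {M} (λ i → components-of-homogeneous p (toℕ i))) (sum-coefficients r _ M l)
    bound (plus {f} {g} a b) =
      let N , α = bound a
          N′ , β = bound b
      in N ⊔ N′ , λ M l → trans
           (∑-distrib-+ {M} (λ i → components f (toℕ i)) (λ i → components g (toℕ i)))
           (+-cong (α M (ℕₚ.m⊔n≤o⇒m≤o N N′ l)) (β M (ℕₚ.m⊔n≤o⇒n≤o N N′ l)))
    bound (resp e a) =
      let N , α = bound a
      in N , λ M l → trans (sum-cong-≋ {M} (λ i → components-cong (sym e) (toℕ i)))
                           (trans (α M l) e)

  components-sum : ∀ f → ∃ λ N → sum {N} (λ i → components f (toℕ i)) ≈ f
  components-sum f = let N , α = bound (sums f) in N , α N ℕₚ.≤-refl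

Symmetric : ∀ {X} → Poly X → Set
Symmetric {X} f = ∀ (σ : X ↔ X) → _≋_ X (rename (Inverse.to σ) f) f

module _ (X : Set) where
  private
    module P = CommutativeRing (polyRing X)
    open Components X

    symRing : CRing
    symRing = subring (polyRing X) Symmetric
      (λ σ → ≋-refl) (λ σ → ≋-refl)
      (λ p q σ → ⊕-cong (p σ) (q σ)) (λ p q σ → ⊗-cong (p σ) (q σ)) (λ p σ → ⊝-cong (p σ))

    module S = CommutativeRing symRing

    SymHomogeneous : ℕ → S.Carrier → Set
    SymHomogeneous r f = PolyHomogeneous X r (proj₁ f)

    rename-conv : ∀ (u : X → X) f g t →
      _≋_ X (rename u (PowerSeries.conv (polyRing X) f g t))
            (PowerSeries.conv (polyRing X) (λ i → rename u (f i)) (λ i → rename u (g i)) t)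
    rename-conv u f g zero    = ≋-refl
    rename-conv u f g (suc t) = ⊕-cong ≋-refl (rename-conv u (λ i → f (suc i)) g t)

    rename-components : ∀ (u : X → X) f t →
      _≋_ X (rename u (components f t)) (components (rename u f) t)
    rename-components u (var x) zero          = ≋-refl
    rename-components u (var x) (suc zero)    = ≋-refl
    rename-components u (var x) (suc (suc t)) = ≋-refl
    rename-components u 𝟎 t                   = ≋-refl
    rename-components u 𝟏 zero                = ≋-refl
    rename-components u 𝟏 (suc t)             = ≋-refl
    rename-components u (f ⊕ g) t = ⊕-cong (rename-components u f t) (rename-components u g t)
    rename-components u (f ⊗ g) t = ≋-trans (rename-conv u (components f) (components g) t)
      (PowerSeries.conv-cong (polyRing X) (rename-components u f) (rename-components u g) t)
    rename-components u (⊝ f) t = ⊝-cong (rename-components u f t)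

    symComponents : S.Carrier → ℕ → S.Carrier
    symComponents (f , p) r = components f r , λ σ →
      ≋-trans (rename-components (Inverse.to σ) f r) (components-cong (p σ) r)

    underlying-isRingHom : RingHom symRing (polyRing X) proj₁
    underlying-isRingHom = mkRingHom {symRing} {polyRing X} (λ e → e) ≋-refl ≋-refl
      (λ _ _ → ≋-refl) (λ _ _ → ≋-refl) (λ _ → ≋-refl)

    sums : ∀ {N} (c : Fin N → S.Carrier) → (∀ i → SymHomogeneous (toℕ i) (c i)) →
           HomogeneousSum symRing SymHomogeneous (Summation.sum symRing c)
    sums c p = go c (λ i → toℕ i , p i)
      where
      go : ∀ {N} (c : Fin N → S.Carrier) → (∀ i → ∃ λ r → SymHomogeneous r (c i)) →
           HomogeneousSum symRing SymHomogeneous (Summation.sum symRing c)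
      go {zero}  c p = single (hom-𝟎 {r = 0})
      go {suc N} c p = plus (single (proj₂ (p fzero))) (go (λ i → c (fsuc i)) (λ i → p (fsuc i)))

  SymmetricPolynomials : GradedRing
  SymmetricPolynomials = record
    { commutativeRing = symRing
    ; Homogeneous = SymHomogeneous
    ; homogeneous-resp = hom-resp
    ; homogeneous-0 = hom-𝟎
    ; homogeneous-+ = hom-⊕
    ; homogeneous-neg = hom-⊝
    ; homogeneous-1 = hom-𝟏
    ; homogeneous-* = hom-⊗
    ; decompose = λ f →
        let N , e = components-sum (proj₁ f)
            c : Fin N → S.Carrier
            c i = symComponents f (toℕ i)
        in resp {x = Summation.sum symRing c} {y = f}
             (≋-trans (hom-sum {symRing} {polyRing X} underlying-isRingHom c) e)
             (sums c (λ i → components-graded (proj₁ f) (toℕ i)))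
    ; independent = λ c p e → components-independent (λ i → proj₁ (c i)) p
        (≋-trans (≋-sym (hom-sum {symRing} {polyRing X} underlying-isRingHom c)) e)
    }

-- X as a decidable subset of the indeterminates Y.
record Part (X Y : Set) : Set where
  field
    include          : X → Y
    restrict         : Y → Maybe X
    restrict-include : ∀ x → restrict (include x) ≡ just x
    include-restrict : ∀ {y x} → restrict y ≡ just x → include x ≡ y

  -- Sets the indeterminates outside X to zero.
  truncate : Y → Poly X
  truncate y = maybe′ var 𝟎 (restrict y)

  -- A permutation of X, extended by the identity.
  extend : (X → X) → Y → Y
  extend u y = maybe′ (λ x → include (u x)) y (restrict y)

  extend-inverse : ∀ {u v} → (∀ x → u (v x) ≡ x) → ∀ y → extend u (extend v y) ≡ y
  extend-inverse {u} {v} e y with restrict y in eq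
  ... | just x rewrite restrict-include (v x) = ≡.trans (≡.cong include (e x)) (include-restrict eq)
  ... | nothing rewrite eq = ≡.refl

  extend-↔ : X ↔ X → Y ↔ Y
  extend-↔ σ = mk↔ₛ′ (extend to) (extend from)
    (extend-inverse strictlyInverseˡ) (extend-inverse strictlyInverseʳ)
    where open Inverse σ

  truncate-extend : ∀ u y → _≋_ X (rename u (truncate y)) (truncate (extend u y))
  truncate-extend u y with restrict y in eq
  ... | just x rewrite restrict-include (u x) = ≋-refl
  ... | nothing rewrite eq = ≋-refl

  truncate-homogeneous : ∀ y → PolyHomogeneous X 1 (truncate y)
  truncate-homogeneous y with restrict y
  ... | just x  = hom-var
  ... | nothing = hom-𝟎

  truncate-symmetric : ∀ {f} → Symmetric f → Symmetric (substitute truncate f)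
  truncate-symmetric {f} p σ = ≋-trans
    (hom-unique (polyRing X)
      (∘RingHom (polyRing Y) (polyRing X) (polyRing X)
        (substitute-isRingHom truncate) (rename-isRingHom (Inverse.to σ)))
      (∘RingHom (polyRing Y) (polyRing Y) (polyRing X)
        (rename-isRingHom (extend (Inverse.to σ))) (substitute-isRingHom truncate))
      (truncate-extend (Inverse.to σ)) f)
    (eval-cong (polyRing X) truncate (p (extend-↔ σ)))

  setZero : GradedHom (SymmetricPolynomials Y) (SymmetricPolynomials X)
  setZero = record
    { ⟦_⟧ = λ f → substitute truncate (proj₁ f) , truncate-symmetric (proj₂ f)
    ; isRingHom = mkRingHom
        {GradedRing.commutativeRing (SymmetricPolynomials Y)}
        {GradedRing.commutativeRing (SymmetricPolynomials X)}
        (eval-cong (polyRing X) truncate) ≋-refl ≋-refl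
        (λ _ _ → ≋-refl) (λ _ _ → ≋-refl) (λ _ → ≋-refl)
    ; preservesDegree = substitute-homogeneous truncate truncate-homogeneous
    }

record ℕ⁺ : Set where
  constructor pos
  field
    value     : ℕ
    .value≥1  : 1 ≤ value

open ℕ⁺ public using (value)

sucℕ⁺ : ℕ⁺ → ℕ⁺
sucℕ⁺ m = pos (suc (value m)) (s≤s z≤n)

module Projections (n : ℕ) where

  -- The indeterminates a_{p μ₁ … μ_d} with 1 ≤ p ≤ m and 0 ≤ d ≤ k.
  record Indeterminate (m k : ℕ) : Set where
    no-eta-equality; pattern
    constructor indeterminate
    field
      p d  : ℕ
      μ    : Vec (Fin n) d
      .1≤p : 1 ≤ p
      .p≤m : p ≤ m
      .d≤k : d ≤ k

  hPart : ∀ m k → Part (Indeterminate m k) (Indeterminate (suc m) k)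
  hPart m k = record
    { include = include
    ; restrict = restrict
    ; restrict-include = restrict-include
    ; include-restrict = λ {y} → include-restrict y
    }
    where
    include : Indeterminate m k → Indeterminate (suc m) k
    include (indeterminate p d μ 1≤p p≤m d≤k) =
      indeterminate p d μ 1≤p (ℕₚ.m≤n⇒m≤1+n p≤m) d≤k

    restrict : Indeterminate (suc m) k → Maybe (Indeterminate m k)
    restrict (indeterminate p d μ 1≤p p≤1+m d≤k) with p ℕₚ.≟ suc m
    ... | yes _     = nothing
    ... | no  p≢1+m = just (indeterminate p d μ 1≤p (ℕₚ.≤-pred (ℕₚ.≤∧≢⇒< p≤1+m p≢1+m)) d≤k)

    restrict-include : ∀ x → restrict (include x) ≡ just x
    restrict-include (indeterminate p d μ 1≤p p≤m d≤k) with p ℕₚ.≟ suc m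
    ... | yes ≡.refl = contradiction-irr p≤m (ℕₚ.<-irrefl ≡.refl)
    ... | no  _      = ≡.refl

    include-restrict : ∀ y {x} → restrict y ≡ just x → include x ≡ y
    include-restrict (indeterminate p d μ 1≤p p≤1+m d≤k) e with p ℕₚ.≟ suc m
    include-restrict (indeterminate p d μ 1≤p p≤1+m d≤k) () | yes _
    include-restrict (indeterminate p d μ 1≤p p≤1+m d≤k) ≡.refl | no _ = ≡.refl

  vPart : ∀ m k → Part (Indeterminate m k) (Indeterminate m (suc k))
  vPart m k = record
    { include = include
    ; restrict = restrict
    ; restrict-include = restrict-include
    ; include-restrict = λ {y} → include-restrict y
    }
    where
    include : Indeterminate m k → Indeterminate m (suc k)
    include (indeterminate p d μ 1≤p p≤m d≤k) =
      indeterminate p d μ 1≤p p≤m (ℕₚ.m≤n⇒m≤1+n d≤k)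

    restrict : Indeterminate m (suc k) → Maybe (Indeterminate m k)
    restrict (indeterminate p d μ 1≤p p≤m d≤1+k) with d ℕₚ.≟ suc k
    ... | yes _     = nothing
    ... | no  d≢1+k = just (indeterminate p d μ 1≤p p≤m (ℕₚ.≤-pred (ℕₚ.≤∧≢⇒< d≤1+k d≢1+k)))

    restrict-include : ∀ x → restrict (include x) ≡ just x
    restrict-include (indeterminate p d μ 1≤p p≤m d≤k) with d ℕₚ.≟ suc k
    ... | yes ≡.refl = contradiction-irr d≤k (ℕₚ.<-irrefl ≡.refl)
    ... | no  _      = ≡.refl

    include-restrict : ∀ y {x} → restrict y ≡ just x → include x ≡ y
    include-restrict (indeterminate p d μ 1≤p p≤m d≤1+k) e with d ℕₚ.≟ suc k
    include-restrict (indeterminate p d μ 1≤p p≤m d≤1+k) () | yes _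
    include-restrict (indeterminate p d μ 1≤p p≤m d≤1+k) ≡.refl | no _ = ≡.refl

  Λₘₖ : ℕ → ℕ → GradedRing
  Λₘₖ m k = SymmetricPolynomials (Indeterminate m k)

  -- In the usual indexing these are h_{m+1,k} and v_{m,k+1}.
  h : ∀ m k → GradedHom (Λₘₖ (suc m) k) (Λₘₖ m k)
  h m k = Part.setZero (hPart m k)

  v : ∀ m k → GradedHom (Λₘₖ m (suc k)) (Λₘₖ m k)
  v m k = Part.setZero (vPart m k)

  φ′ : ∀ {m₁ m₂} → m₁ ≤′ m₂ → ∀ k → GradedHom (Λₘₖ m₂ k) (Λₘₖ m₁ k)
  φ′ (≤′-reflexive ≡.refl)   k = idHom
  φ′ (≤′-step {n = m₂} m₁≤m₂) k = φ′ m₁≤m₂ k ∘ᴳ h m₂ k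

  ψ′ : ∀ m {k₁ k₂} → k₁ ≤′ k₂ → GradedHom (Λₘₖ m k₂) (Λₘₖ m k₁)
  ψ′ m (≤′-reflexive ≡.refl)   = idHom
  ψ′ m (≤′-step {n = k₂} k₁≤k₂) = ψ′ m k₁≤k₂ ∘ᴳ v m k₂

  φₘₖ : ∀ {m₁ m₂} → m₁ ≤ m₂ → ∀ k → GradedHom (Λₘₖ m₂ k) (Λₘₖ m₁ k)
  φₘₖ m₁≤m₂ = φ′ (ℕₚ.≤⇒≤′ m₁≤m₂)

  ψₘₖ : ∀ m {k₁ k₂} → k₁ ≤ k₂ → GradedHom (Λₘₖ m k₂) (Λₘₖ m k₁)
  ψₘₖ m k₁≤k₂ = ψ′ m (ℕₚ.≤⇒≤′ k₁≤k₂)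

  Λₖ-diagram Λₘ-diagram : ℕ → Diagram
  Λₖ-diagram k = record
    { Vertex = ℕ⁺ ; Edge = ℕ⁺ ; src = sucℕ⁺ ; tgt = λ m → m
    ; obj = λ m → Λₘₖ (value m) k
    ; arr = λ m → h (value m) k
    }
  Λₘ-diagram m = record
    { Vertex = ℕ ; Edge = ℕ ; src = suc ; tgt = λ k → k
    ; obj = λ k → Λₘₖ m k
    ; arr = λ k → v m k
    }

  -- Λₖ k is Λ_{·,k} and Λₘ m is Λ_{m,·}: the subscript names the bounded index.
  Λₖ : ℕ → GradedRing
  Λₖ k = Lim (Λₖ-diagram k)

  Λₘ : ℕ → GradedRing
  Λₘ m = Lim (Λₘ-diagram m)

  Hₘₖ : ∀ m → .(1 ≤ m) → ∀ k → GradedHom (Λₖ k) (Λₘₖ m k)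
  Hₘₖ m 1≤m k = π (Λₖ-diagram k) (pos m 1≤m)

  Vₘₖ : ∀ m k → GradedHom (Λₘ m) (Λₘₖ m k)
  Vₘₖ m k = π (Λₘ-diagram m) k

  h∘v : ∀ m k → h m k ∘ᴳ v (suc m) k ≐ v m k ∘ᴳ h m (suc k)
  h∘v m k (f , _) = hom-unique (polyRing (Indeterminate m k))
    (∘RingHom (polyRing (Indeterminate (suc m) (suc k))) (polyRing (Indeterminate (suc m) k))
      (polyRing (Indeterminate m k))
      (substitute-isRingHom (Part.truncate (vPart (suc m) k)))
      (substitute-isRingHom (Part.truncate (hPart m k))))
    (∘RingHom (polyRing (Indeterminate (suc m) (suc k))) (polyRing (Indeterminate m (suc k)))
      (polyRing (Indeterminate m k))
      (substitute-isRingHom (Part.truncate (hPart m (suc k))))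
      (substitute-isRingHom (Part.truncate (vPart m k))))
    agree f
    where
    agree : ∀ x → _≋_ (Indeterminate m k)
      (substitute (Part.truncate (hPart m k)) (Part.truncate (vPart (suc m) k) x))
      (substitute (Part.truncate (vPart m k)) (Part.truncate (hPart m (suc k)) x))
    agree (indeterminate p d μ 1≤p p≤1+m d≤1+k)
      with d ℕₚ.≟ suc k in d-eq | p ℕₚ.≟ suc m in p-eq
    ... | yes _ | yes _ = ≋-refl
    ... | yes _ | no  _ rewrite d-eq = ≋-refl
    ... | no  _ | yes _ rewrite p-eq = ≋-refl
    ... | no  _ | no  _ rewrite p-eq | d-eq = ≋-refl

  v∘φ′ : ∀ {m₁ m₂} (l : m₁ ≤′ m₂) k → v m₁ k ∘ᴳ φ′ l (suc k) ≐ φ′ l k ∘ᴳ v m₂ k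
  v∘φ′ (≤′-reflexive ≡.refl) k f = ≋-refl
  v∘φ′ (≤′-step {n = m₂} l) k f = ≋-trans (v∘φ′ l k (⟦ h m₂ (suc k) ⟧ f))
    (≋-sym (GradedHom.⟦⟧-cong (φ′ l k) {⟦ h m₂ k ⟧ (⟦ v (suc m₂) k ⟧ f)}
      {⟦ v m₂ k ⟧ (⟦ h m₂ (suc k) ⟧ f)} (h∘v m₂ k f)))

  h∘ψ′ : ∀ m {k₁ k₂} (l : k₁ ≤′ k₂) → h m k₁ ∘ᴳ ψ′ (suc m) l ≐ ψ′ m l ∘ᴳ h m k₂
  h∘ψ′ m (≤′-reflexive ≡.refl) f = ≋-refl
  h∘ψ′ m (≤′-step {n = k₂} l) f = ≋-trans (h∘ψ′ m l (⟦ v (suc m) k₂ ⟧ f))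
    (GradedHom.⟦⟧-cong (ψ′ m l) {⟦ h m k₂ ⟧ (⟦ v (suc m) k₂ ⟧ f)}
      {⟦ v m k₂ ⟧ (⟦ h m (suc k₂) ⟧ f)} (h∘v m k₂ f))

  φ : ∀ {m₁ m₂} → m₁ ≤ m₂ → GradedHom (Λₘ m₂) (Λₘ m₁)
  φ {m₁} {m₂} m₁≤m₂ = lift (Λₘ-diagram m₁) (λ k → φₘₖ m₁≤m₂ k ∘ᴳ Vₘₖ m₂ k)
    λ k x → ≋-trans (v∘φ′ (ℕₚ.≤⇒≤′ m₁≤m₂) k (⟦ Vₘₖ m₂ (suc k) ⟧ x))
      (GradedHom.⟦⟧-cong (φₘₖ m₁≤m₂ k) {⟦ v m₂ k ⟧ (⟦ Vₘₖ m₂ (suc k) ⟧ x)} {⟦ Vₘₖ m₂ k ⟧ x}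
        (π-compatible (Λₘ-diagram m₂) k x))

  ψ : ∀ {k₁ k₂} → k₁ ≤ k₂ → GradedHom (Λₖ k₂) (Λₖ k₁)
  ψ {k₁} {k₂} k₁≤k₂ = lift (Λₖ-diagram k₁) (λ m → ψₘₖ (value m) k₁≤k₂ ∘ᴳ π (Λₖ-diagram k₂) m)
    λ m x → ≋-trans (h∘ψ′ (value m) (ℕₚ.≤⇒≤′ k₁≤k₂) (⟦ π (Λₖ-diagram k₂) (sucℕ⁺ m) ⟧ x))
      (GradedHom.⟦⟧-cong (ψₘₖ (value m) k₁≤k₂)
        {⟦ h (value m) k₂ ⟧ (⟦ π (Λₖ-diagram k₂) (sucℕ⁺ m) ⟧ x)} {⟦ π (Λₖ-diagram k₂) m ⟧ x}
        (π-compatible (Λₖ-diagram k₂) m x))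

  -- A symmetric function f in all the indeterminates is given by the
  -- polynomials f_{m,k} obtained by setting to zero the indeterminates with
  -- p > m or d > k.
  Λ-diagram : Diagram
  Λ-diagram = record
    { Vertex = ℕ⁺ × ℕ
    ; Edge = ℕ⁺ × ℕ ⊎ ℕ⁺ × ℕ
    ; src = λ { (inj₁ (m , k)) → sucℕ⁺ m , k ; (inj₂ (m , k)) → m , suc k }
    ; tgt = λ { (inj₁ mk) → mk ; (inj₂ mk) → mk }
    ; obj = λ (m , k) → Λₘₖ (value m) k
    ; arr = λ { (inj₁ (m , k)) → h (value m) k ; (inj₂ (m , k)) → v (value m) k }
    }

  Λ : GradedRing
  Λ = Lim Λ-diagram

  H′ : ∀ m → GradedHom Λ (Λₘ (value m))
  H′ m = lift (Λₘ-diagram (value m)) (λ k → π Λ-diagram (m , k))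
    λ k → π-compatible Λ-diagram (inj₂ (m , k))

  H : ∀ m → .(1 ≤ m) → GradedHom Λ (Λₘ m)
  H m 1≤m = H′ (pos m 1≤m)

  V : ∀ k → GradedHom Λ (Λₖ k)
  V k = lift (Λₖ-diagram k) (λ m → π Λ-diagram (m , k))
    λ m → π-compatible Λ-diagram (inj₁ (m , k))

  -- Λ is the inverse limit of the Λₘ along φ, with projections H, and of the
  -- Λₖ along ψ, with projections V.
  rowsDiagram columnsDiagram : Diagram
  rowsDiagram = record
    { Vertex = ℕ⁺ ; Edge = ℕ⁺ ; src = sucℕ⁺ ; tgt = λ m → m
    ; obj = λ m → Λₘ (value m)
    ; arr = λ m → φ (ℕₚ.n≤1+n (value m))
    }
  columnsDiagram = record
    { Vertex = ℕ ; Edge = ℕ ; src = suc ; tgt = λ k → k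
    ; obj = Λₖ
    ; arr = λ k → ψ (ℕₚ.n≤1+n k)
    }

  φ′-h : ∀ {m} (l : m ≤′ suc m) k → φ′ l k ≐ h m k
  φ′-h (≤′-step (≤′-reflexive ≡.refl)) k f = ≋-refl
  φ′-h (≤′-step (≤′-step l)) k f = contradiction-irr (ℕₚ.≤′⇒≤ l) (ℕₚ.<-irrefl ≡.refl)

  ψ′-v : ∀ m {k} (l : k ≤′ suc k) → ψ′ m l ≐ v m k
  ψ′-v m (≤′-step (≤′-reflexive ≡.refl)) f = ≋-refl
  ψ′-v m (≤′-step (≤′-step l)) f = contradiction-irr (ℕₚ.≤′⇒≤ l) (ℕₚ.<-irrefl ≡.refl)

  Λ≅lim-rows : Λ ≅ Lim rowsDiagram
  Λ≅lim-rows = record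
    { to = lift rowsDiagram H′ λ m x k →
        ≋-trans (φ′-h (ℕₚ.≤⇒≤′ (ℕₚ.n≤1+n (value m))) k (⟦ π Λ-diagram (sucℕ⁺ m , k) ⟧ x))
                (π-compatible Λ-diagram (inj₁ (m , k)) x)
    ; from = lift Λ-diagram (λ (m , k) → Vₘₖ (value m) k ∘ᴳ π rowsDiagram m) λ
        { (inj₁ (m , k)) x → ≋-trans
            (≋-sym (φ′-h (ℕₚ.≤⇒≤′ (ℕₚ.n≤1+n (value m))) k
              (⟦ Vₘₖ (suc (value m)) k ∘ᴳ π rowsDiagram (sucℕ⁺ m) ⟧ x)))
            (π-compatible rowsDiagram m x k)
        ; (inj₂ (m , k)) x → π-compatible (Λₘ-diagram (value m)) k (⟦ π rowsDiagram m ⟧ x)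
        }
    ; to∘from = λ _ _ _ → ≋-refl
    ; from∘to = λ _ _ → ≋-refl
    }

  Λ≅lim-columns : Λ ≅ Lim columnsDiagram
  Λ≅lim-columns = record
    { to = lift columnsDiagram V λ k x m →
        ≋-trans (ψ′-v (value m) (ℕₚ.≤⇒≤′ (ℕₚ.n≤1+n k)) (⟦ π Λ-diagram (m , suc k) ⟧ x))
                (π-compatible Λ-diagram (inj₂ (m , k)) x)
    ; from = lift Λ-diagram (λ (m , k) → π (Λₖ-diagram k) m ∘ᴳ π columnsDiagram k) λ
        { (inj₁ (m , k)) x → π-compatible (Λₖ-diagram k) m (⟦ π columnsDiagram k ⟧ x)
        ; (inj₂ (m , k)) x → ≋-trans
            (≋-sym (ψ′-v (value m) (ℕₚ.≤⇒≤′ (ℕₚ.n≤1+n k))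
              (⟦ π (Λₖ-diagram (suc k)) m ∘ᴳ π columnsDiagram (suc k) ⟧ x)))
            (π-compatible columnsDiagram k x m)
        }
    ; to∘from = λ _ _ _ → ≋-refl
    ; from∘to = λ _ _ → ≋-refl
    }

{-# OPTIONS --safe #-}
module Submission where

open import Defs
open import Data.Nat.Base using (ℕ; suc; _≤_; _+_; _∸_; z≤n; s≤s; _≤′_; ≤′-reflexive; ≤′-step)
open import Data.Nat.Properties using (≤-trans; m≤m+n; m∸n≤m; ≤⇒≤′)
open import Data.Product.Base using (_×_; _,_)
open import Relation.Binary.PropositionalEquality.Core using (refl)

-- Elements of the limits are compatible families, and every arrow meeting a limit selects entries
-- or acts entrywise, so the five squares in the top row or left column commute by definition. The
-- other four involve polynomials only: setting indeterminates to zero by their first index and by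
-- their number of subscripts can be done in either order. For single steps this is `h∘v`, checked
-- on indeterminates; induction along each direction gives the rest.

module _ (n : ℕ) where
  open Projections n

  -- Pastes unit-width squares side by side by induction on `l`; each has full height `l′` and
  -- commutes by `h∘ψ′`.
  ψ′∘φ′ : ∀ {m₁ m₂ k₁ k₂} (l : m₁ ≤′ m₂) (l′ : k₁ ≤′ k₂) →
          Commutes (φ′ l k₂) (ψ′ m₂ l′) (ψ′ m₁ l′) (φ′ l k₁)
  ψ′∘φ′ (≤′-reflexive refl) l′ f = ≋-refl
  ψ′∘φ′ {k₁ = k₁} {k₂} (≤′-step {n = m₂} l) l′ f = ≋-trans
    (ψ′∘φ′ l l′ (⟦ h m₂ k₂ ⟧ f))
    (≋-sym (GradedHom.⟦⟧-cong (φ′ l k₁)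
      {⟦ h m₂ k₁ ⟧ (⟦ ψ′ (suc m₂) l′ ⟧ f)} {⟦ ψ′ m₂ l′ ⟧ (⟦ h m₂ k₂ ⟧ f)}
      (h∘ψ′ m₂ l′ f)))

theorem3 :
  (n m k p q : ℕ) → 1 ≤ n → (m≥2 : 2 ≤ m) → 1 ≤ k →
  let open Projections n
      m≥1   : 1 ≤ m
      m≥1   = ≤-trans (s≤s z≤n) m≥2
      m+p≥1 : 1 ≤ m + p
      m+p≥1 = ≤-trans m≥1 (m≤m+n m p)
      m≤m+p : m ≤ m + p
      m≤m+p = m≤m+n m p
      m-1≤m : m ∸ 1 ≤ m
      m-1≤m = m∸n≤m m 1
      k≤k+q : k ≤ k + q
      k≤k+q = m≤m+n k q
      k-1≤k : k ∸ 1 ≤ k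
      k-1≤k = m∸n≤m k 1
  in
    Commutes (H (m + p) m+p≥1)            (V (k + q))          (Vₘₖ (m + p) (k + q))  (Hₘₖ (m + p) m+p≥1 (k + q))
  × Commutes (φ m≤m+p)                    (Vₘₖ (m + p) (k + q)) (Vₘₖ m (k + q))        (φₘₖ m≤m+p (k + q))
  × Commutes (φ m-1≤m)                    (Vₘₖ m (k + q))       (Vₘₖ (m ∸ 1) (k + q))  (φₘₖ m-1≤m (k + q))
  × Commutes (Hₘₖ (m + p) m+p≥1 (k + q))  (ψ k≤k+q)            (ψₘₖ (m + p) k≤k+q)    (Hₘₖ (m + p) m+p≥1 k)
  × Commutes (φₘₖ m≤m+p (k + q))          (ψₘₖ (m + p) k≤k+q)  (ψₘₖ m k≤k+q)          (φₘₖ m≤m+p k)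
  × Commutes (φₘₖ m-1≤m (k + q))          (ψₘₖ m k≤k+q)        (ψₘₖ (m ∸ 1) k≤k+q)    (φₘₖ m-1≤m k)
  × Commutes (Hₘₖ (m + p) m+p≥1 k)        (ψ k-1≤k)            (ψₘₖ (m + p) k-1≤k)    (Hₘₖ (m + p) m+p≥1 (k ∸ 1))
  × Commutes (φₘₖ m≤m+p k)                (ψₘₖ (m + p) k-1≤k)  (ψₘₖ m k-1≤k)          (φₘₖ m≤m+p (k ∸ 1))
  × Commutes (φₘₖ m-1≤m k)                (ψₘₖ m k-1≤k)        (ψₘₖ (m ∸ 1) k-1≤k)    (φₘₖ m-1≤m (k ∸ 1))
theorem3 n m k p q _ m≥2 _ =
    -- Both composites read off the entry at `(m + p , k + q)`.
    (λ _ → ≋-refl)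
  -- The entry of `φ` at `k + q` is by construction `φₘₖ` of that entry; likewise for `ψ` below.
  , (λ _ → ≋-refl)
  , (λ _ → ≋-refl)
  , (λ _ → ≋-refl)
  , ψ′∘φ′ n (≤⇒≤′ (m≤m+n m p)) (≤⇒≤′ (m≤m+n k q))
  , ψ′∘φ′ n (≤⇒≤′ (m∸n≤m m 1)) (≤⇒≤′ (m≤m+n k q))
  , (λ _ → ≋-refl)
  , ψ′∘φ′ n (≤⇒≤′ (m≤m+n m p)) (≤⇒≤′ (m∸n≤m k 1))
  , ψ′∘φ′ n (≤⇒≤′ (m∸n≤m m 1)) (≤⇒≤′ (m∸n≤m k 1))
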